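{- Let $n\ge 1$ and let $\mathbb{P}$ be a set of distinct unique configurations of length $n$. Then $K(n)=\Omega(\log|\mathbb{P}|)$; more precisely $K(n)\ge\lceil\log_3|\mathbb{P}|\rceil$.
   Context: For a real sequence $A=(a_1,\dots,a_n)$, a configuration is a sequence $P=(p_1,\dots,p_n)$ with $p_\ell\in\{1,\dots,n-\ell+1\}$ for each $\ell$; $P$ is an output configuration for $A$ if for every $\ell=1,\dots,n$ the sum $a_{p_\ell}+\dots+a_{p_\ell+\ell-1}$ is maximum among all sums of $\ell$ consecutive entries of $A$. Let $\mathcal{P}(A)$ be the set of output configurations of $A$. A configuration $P$ is unique if there exists $A\in\mathbb{R}^n$ with $\mathcal{P}(A)=\{P\}$. The MCSP (in this form) asks, given $A$, to output some output configuration for $A$. A decision tree algorithm for inputs of length $n$ is a ternary tree: each internal node holds a test "$f(A)<0$, $=0$, or $>0$?" for some rational function $f$ of the $n$ inputs, with one branch per outcome; each leaf holds functions $g_1,\dots,g_n$ and outputs $P=(g_1(A),\dots,g_n(A))$. The tree solves MCSP if for every input $A$ the output at the reached leaf is an output configuration for $A$. Its cost is its height, and $K(n)$ is the minimum cost of a decision tree solving MCSP for inputs of length $n$.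
   Formalization: The functions g_1,…,g_n at the leaves are required to be rational functions, like the tests, and must be defined on the inputs that reach them; with arbitrary functions a single leaf solves MCSP, so K(n)=0 and the claim fails already for n=2. -}

module Defs where

open import Algebra.Bundles using (CommutativeRing)
open import Data.List.Base as List using (List; take; drop)
open import Data.Fin.Base using (Fin; toℕ)
open import Data.Nat.Base as ℕ using (ℕ; zero; suc; z≤n; s≤s; _∸_; _⊔_)
import Data.Nat.Properties as ℕ
open import Data.Product.Base using (∃; _×_; _,_)
open import Data.Sum.Base using (_⊎_)
open import Data.Vec.Base as Vec using (Vec; lookup; zipWith; foldr′)
open import Function.Bundles using (_⇔_; mk⇔)
open import Level using (0ℓ)
open import Relation.Binary.Core using (Rel)
open import Relation.Binary.PropositionalEquality using (_≡_; refl; sym; subst)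
open import Relation.Binary.Structures using (IsStrictTotalOrder)
open import Relation.Nullary using (¬_; yes; no)

-- The classical axioms for ℝ, which determine it up to isomorphism.
-- Trichotomy is part of IsStrictTotalOrder: a ternary test on real
-- inputs always has exactly one of its three outcomes.

record CompleteOrderedField : Set₁ where
  field
    commutativeRing : CommutativeRing 0ℓ 0ℓ

  open CommutativeRing commutativeRing public

  infix 4 _<_ _≤_

  field
    _<_                : Rel Carrier 0ℓ
    isStrictTotalOrder : IsStrictTotalOrder _≈_ _<_
    0≉1                : ¬ (0# ≈ 1#)
    inverse            : ∀ x → ¬ (x ≈ 0#) → ∃ λ y → x * y ≈ 1#
    +-monoˡ-<          : ∀ z {x y} → x < y → x + z < y + z
    *-positive         : ∀ {x y} → 0# < x → 0# < y → 0# < x * y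

  _≤_ : Rel Carrier 0ℓ
  x ≤ y = x < y ⊎ x ≈ y

  IsUpperBound : (Carrier → Set) → Carrier → Set
  IsUpperBound S b = ∀ x → S x → x ≤ b

  field
    supremum : (S : Carrier → Set) → ∃ S → ∃ (IsUpperBound S) →
               ∃ λ s → IsUpperBound S s × (∀ b → IsUpperBound S b → s ≤ b)

-- ⌈log₃ N⌉ is the least m with N ≤ 3 ^ m; in particular ⌈log₃ 0⌉ = 0.

private
  leastFrom : (fuel m N : ℕ) → ℕ
  leastFrom zero       m N = m
  leastFrom (suc fuel) m N with N ℕ.≤? 3 ℕ.^ m
  ... | yes _ = m
  ... | no  _ = leastFrom fuel (suc m) N

⌈log₃_⌉ : ℕ → ℕ
⌈log₃ N ⌉ = leastFrom N 0 N

private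
  n≤3^n : ∀ n → n ℕ.≤ 3 ℕ.^ n
  n≤3^n zero    = z≤n
  n≤3^n (suc n) = ℕ.≤-trans
    (ℕ.+-mono-≤ (ℕ.m^n>0 3 n) (n≤3^n n))
    (ℕ.+-monoʳ-≤ (3 ℕ.^ n) (ℕ.m≤m+n (3 ℕ.^ n) _))

  leastFrom-upper : ∀ fuel m N → N ℕ.≤ 3 ℕ.^ (fuel ℕ.+ m) →
                    N ℕ.≤ 3 ℕ.^ leastFrom fuel m N
  leastFrom-upper zero       m N h = h
  leastFrom-upper (suc fuel) m N h with N ℕ.≤? 3 ℕ.^ m
  ... | yes N≤3^m = N≤3^m
  ... | no  _     = leastFrom-upper fuel (suc m) N
    (subst (λ e → N ℕ.≤ 3 ℕ.^ e) (sym (ℕ.+-suc fuel m)) h)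

  leastFrom-least : ∀ fuel m N k → m ℕ.≤ k → N ℕ.≤ 3 ℕ.^ k →
                    leastFrom fuel m N ℕ.≤ k
  leastFrom-least zero       m N k m≤k h = m≤k
  leastFrom-least (suc fuel) m N k m≤k h with N ℕ.≤? 3 ℕ.^ m
  ... | yes _     = m≤k
  ... | no  N≰3^m = leastFrom-least fuel (suc m) N k
    (ℕ.≤∧≢⇒< m≤k λ { refl → N≰3^m h }) h

⌈log₃⌉≤⇔≤3^ : ∀ N k → ⌈log₃ N ⌉ ℕ.≤ k ⇔ N ℕ.≤ 3 ℕ.^ k
⌈log₃⌉≤⇔≤3^ N k = mk⇔
  (λ h → ℕ.≤-trans
    (leastFrom-upper N 0 N
      (subst (λ e → N ℕ.≤ 3 ℕ.^ e) (sym (ℕ.+-identityʳ N)) (n≤3^n N)))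
    (ℕ.^-monoʳ-≤ 3 h))
  (leastFrom-least N 0 N k z≤n)

module MCSP (ℝ : CompleteOrderedField) where

  open CompleteOrderedField ℝ
  open import Algebra.Properties.Semiring.Exp semiring using (_^_)
  open import Algebra.Properties.Semiring.Mult semiring
    using () renaming (_×_ to _·_)

  fromℕ : ℕ → Carrier
  fromℕ m = m · 1#

  Sequence : ℕ → Set
  Sequence n = Vec Carrier n

  -- Positions are 1-based:
  -- windowSum A p ℓ = a_p + … + a_{p+ℓ-1}  when 1 ≤ p ≤ n - ℓ + 1.
  windowSum : ∀ {n} → Sequence n → (p ℓ : ℕ) → Carrier
  windowSum A p ℓ = List.foldr _+_ 0# (take ℓ (drop (p ∸ 1) (Vec.toList A)))

  IsStart : (n ℓ p : ℕ) → Set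
  IsStart n ℓ p = 1 ℕ.≤ p × p ℕ.≤ n ∸ ℓ ℕ.+ 1

  -- The index i : Fin n stands for the length ℓ = suc (toℕ i).
  IsConfiguration : ∀ {n} → Vec ℕ n → Set
  IsConfiguration {n} P = ∀ i → IsStart n (suc (toℕ i)) (lookup P i)

  IsOutputConfiguration : ∀ {n} → Sequence n → Vec ℕ n → Set
  IsOutputConfiguration {n} A P =
    IsConfiguration P ×
    (∀ i → let ℓ = suc (toℕ i) in
       ∀ q → IsStart n ℓ q → windowSum A q ℓ ≤ windowSum A (lookup P i) ℓ)

  IsUniqueConfiguration : ∀ {n} → Vec ℕ n → Set
  IsUniqueConfiguration {n} P =
    IsConfiguration P ×
    (∃ λ (A : Sequence n) → ∀ Q → IsOutputConfiguration A Q ⇔ Q ≡ P)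

  Monomial : ℕ → Set
  Monomial n = Carrier × Vec ℕ n

  Polynomial : ℕ → Set
  Polynomial n = List (Monomial n)

  evalMonomial : ∀ {n} → Monomial n → Sequence n → Carrier
  evalMonomial (c , e) A = c * foldr′ _*_ 1# (zipWith _^_ A e)

  eval : ∀ {n} → Polynomial n → Sequence n → Carrier
  eval p A = List.foldr (λ m s → evalMonomial m A + s) 0# p

  -- ℝ being infinite, a polynomial is nonzero iff it is nonzero somewhere.
  record RationalFunction (n : ℕ) : Set where
    field
      numerator   : Polynomial n
      denominator : Polynomial n
      nonzero     : ∃ λ A → ¬ (eval denominator A ≈ 0#)

  -- f is defined at A, with value y.
  HasValue : ∀ {n} → RationalFunction n → Sequence n → Carrier → Set
  HasValue f A y =
    ¬ (eval denominator A ≈ 0#) × y * eval denominator A ≈ eval numerator A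
    where open RationalFunction f

  -- The functions at the leaves are rational, like the tests.  With
  -- arbitrary functions there, a single leaf would solve the problem.
  data DecisionTree (n : ℕ) : Set where
    leaf : Vec (RationalFunction n) n → DecisionTree n
    node : (f : RationalFunction n) (t₋ t₀ t₊ : DecisionTree n) → DecisionTree n

  height : ∀ {n} → DecisionTree n → ℕ
  height (leaf _)          = 0
  height (node _ t₋ t₀ t₊) = suc (height t₋ ⊔ height t₀ ⊔ height t₊)

  -- Outputs t A y: on input A every function met on the path is defined,
  -- and the leaf reached outputs y.
  data Outputs {n} : DecisionTree n → Sequence n → Sequence n → Set where
    leaf : ∀ {g A y} →
           (∀ i → HasValue (lookup g i) A (lookup y i)) →
           Outputs (leaf g) A y
    neg  : ∀ {f t₋ t₀ t₊ A v y} → HasValue f A v → v < 0# →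
           Outputs t₋ A y → Outputs (node f t₋ t₀ t₊) A y
    zer  : ∀ {f t₋ t₀ t₊ A v y} → HasValue f A v → v ≈ 0# →
           Outputs t₀ A y → Outputs (node f t₋ t₀ t₊) A y
    pos  : ∀ {f t₋ t₀ t₊ A v y} → HasValue f A v → 0# < v →
           Outputs t₊ A y → Outputs (node f t₋ t₀ t₊) A y

  SolvesMCSP : ∀ {n} → DecisionTree n → Set
  SolvesMCSP {n} t =
    ∀ (A : Sequence n) →
    ∃ λ P → IsOutputConfiguration A P × Outputs t A (Vec.map fromℕ P)

  -- IsMinimumCost n k says that K(n) = k.
  IsMinimumCost : (n k : ℕ) → Set
  IsMinimumCost n k =
    (∃ λ (t : DecisionTree n) → SolvesMCSP t × height t ≡ k) ×
    (∀ (t : DecisionTree n) → SolvesMCSP t → k ℕ.≤ height t)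

{-# OPTIONS --safe #-}
module Submission where

-- Let C be a point at which no denominator of a function at a leaf of the tree
-- vanishes.  Let A witness that P is unique and move from A towards C: the
-- optima at A are strict, so P stays the only output configuration for a while,
-- and each test, being a ratio of polynomials in one variable on this line, has
-- eventually constant sign.  So all points A + ε(C - A) with ε > 0 small reach
-- one leaf, whose functions take the values P there.  A polynomial in ε with
-- infinitely many zeros vanishes identically, so these functions take the
-- values P at C too (ε = 1).  Since C does not depend on P, the leaf determines
-- P, and a tree of height h has at most 3 ^ h leaves.

open import Defs
open import Data.Empty using (⊥-elim)
open import Data.Fin.Base using (Fin; toℕ; fromℕ<)
open import Data.Fin.Properties using (toℕ-fromℕ<; toℕ<n; injective⇒≤)
  renaming (_≟_ to _≟ᶠ_)
open import Data.List.Base using (List; length; []; _∷_; [_]; _++_; foldr; map;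
  take; drop; allFin; concatMap)
import Data.List.Base as List
open import Data.List.Membership.Propositional using (_∈_; lose)
open import Data.List.Membership.Propositional.Properties
  using (∈-allFin; ∈-++⁺ˡ; ∈-++⁺ʳ; ∈-concatMap⁺; ∈-lookup)
import Data.List.Membership.Setoid.Properties as Membership
open import Data.List.Properties using (length-++)
open import Data.List.Relation.Binary.Pointwise using (Pointwise; []; _∷_)
open import Data.List.Relation.Unary.All as All using (All; []; _∷_)
open import Data.List.Relation.Unary.Any as Any using (here)
open import Data.List.Relation.Unary.AllPairs using (_∷_)
open import Data.List.Relation.Unary.Unique.Propositional using (Unique)
open import Data.Nat.Base as ℕ using (ℕ; zero; suc; s≤s; z≤n; _⊔_; _∸_)
open import Data.Nat.Logarithm using (⌈log₂_⌉; ⌈log₂⌉-mono-≤; ⌈log₂2^n⌉≡n)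
import Data.Nat.Properties as ℕ
open import Data.Product.Base using (∃; _×_; _,_; proj₁; proj₂)
open import Data.Sum.Base using (inj₁; inj₂)
open import Data.Vec.Base as Vec using (Vec; []; _∷_; lookup; foldr′; zipWith;
  toList; _[_]≔_)
open import Data.Vec.Membership.Propositional.Properties
  using () renaming (∈-toList⁺ to ∈ᵛ-toList⁺; ∈-lookup to ∈ᵛ-lookup)
open import Data.Vec.Properties using (lookup∘update; lookup∘update′; lookup-map)
open import Data.Vec.Relation.Binary.Pointwise.Extensional
  using (ext; Pointwise-≡⇒≡)
open import Data.Vec.Relation.Binary.Pointwise.Inductive
  using () renaming (Pointwise to VecPointwise; [] to []ᵛ; _∷_ to _∷ᵛ_)
open import Function.Base using (_∘_)
open import Function.Bundles using (Equivalence)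
open import Relation.Binary.Bundles using (StrictTotalOrder)
open import Relation.Binary.Definitions using (Tri; tri<; tri≈; tri>)
open import Relation.Binary.PropositionalEquality as ≡
  using (_≡_; _≢_; refl; cong; subst)
open import Relation.Binary.Structures using (IsStrictTotalOrder)
open import Relation.Nullary using (¬_; yes; no; contradiction)

-- Arithmetic of ordered fields.

module OrderedFieldProperties (ℝ : CompleteOrderedField) where

  open CompleteOrderedField ℝ renaming (refl to ≈-refl; zero to *-zero)
  open IsStrictTotalOrder isStrictTotalOrder public
    using (compare; _≟_; irrefl; asym; <-respˡ-≈; <-respʳ-≈)
  open import Algebra.Properties.Ring ring public
  open MCSP ℝ using (fromℕ)

  strictTotalOrder : StrictTotalOrder _ _ _
  strictTotalOrder = record { isStrictTotalOrder = isStrictTotalOrder }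

  open import Relation.Binary.Reasoning.StrictPartialOrder
    (StrictTotalOrder.strictPartialOrder strictTotalOrder)

  ≤-trans : ∀ {x y z} → x ≤ y → y ≤ z → x ≤ z
  ≤-trans {x} {y} {z} x≤y y≤z = begin
    x  ≤⟨ x≤y ⟩
    y  ≤⟨ y≤z ⟩
    z  ∎

  ≤⇒≯ : ∀ {x y} → x ≤ y → ¬ y < x
  ≤⇒≯ (inj₁ x<y) y<x = asym x<y y<x
  ≤⇒≯ (inj₂ x≈y) y<x = irrefl (sym x≈y) y<x

  +-monoʳ-< : ∀ z {x y} → x < y → z + x < z + y
  +-monoʳ-< z {x} {y} x<y = begin-strict
    z + x  ≈⟨ +-comm z x ⟩
    x + z  <⟨ +-monoˡ-< z x<y ⟩
    y + z  ≈⟨ +-comm y z ⟩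
    z + y  ∎

  neg⇒-pos : ∀ {x} → x < 0# → 0# < - x
  neg⇒-pos {x} x<0 = begin-strict
    0#        ≈⟨ -‿inverseʳ x ⟨
    x + - x   <⟨ +-monoˡ-< (- x) x<0 ⟩
    0# + - x  ≈⟨ +-identityˡ (- x) ⟩
    - x       ∎

  pos⇒-neg : ∀ {x} → 0# < x → - x < 0#
  pos⇒-neg {x} 0<x = begin-strict
    - x       ≈⟨ +-identityˡ (- x) ⟨
    0# + - x  <⟨ +-monoˡ-< (- x) 0<x ⟩
    x + - x   ≈⟨ -‿inverseʳ x ⟩
    0#        ∎

  x<y⇒0<y-x : ∀ {x y} → x < y → 0# < y - x
  x<y⇒0<y-x {x} {y} x<y = begin-strict
    0#     ≈⟨ -‿inverseʳ x ⟨
    x - x  <⟨ +-monoˡ-< (- x) x<y ⟩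
    y - x  ∎

  0<y-x⇒x<y : ∀ {x y} → 0# < y - x → x < y
  0<y-x⇒x<y {x} {y} 0<y-x = begin-strict
    x            ≈⟨ +-identityˡ x ⟨
    0# + x       <⟨ +-monoˡ-< x 0<y-x ⟩
    (y - x) + x  ≈⟨ //-rightDividesˡ x y ⟩
    y            ∎

  *-monoʳ-< : ∀ {z x y} → 0# < z → x < y → z * x < z * y
  *-monoʳ-< {z} {x} {y} 0<z x<y = 0<y-x⇒x<y (begin-strict
    0#             <⟨ *-positive 0<z (x<y⇒0<y-x x<y) ⟩
    z * (y - x)    ≈⟨ x[y-z]≈xy-xz z y x ⟩
    z * y - z * x  ∎)

  pos*neg⇒neg : ∀ {x y} → 0# < x → y < 0# → x * y < 0#
  pos*neg⇒neg {x} {y} 0<x y<0 = <-respʳ-≈ (zeroʳ x) (*-monoʳ-< 0<x y<0)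

  square-positive : ∀ {x} → ¬ x ≈ 0# → 0# < x * x
  square-positive {x} x≉0 with compare x 0#
  ... | tri≈ _ x≈0 _ = contradiction x≈0 x≉0
  ... | tri> _ _ 0<x = *-positive 0<x 0<x
  ... | tri< x<0 _ _ = begin-strict
    0#             <⟨ *-positive (neg⇒-pos x<0) (neg⇒-pos x<0) ⟩
    - x * - x          ≈⟨ -‿distribˡ-* x (- x) ⟨
    - (x * - x)    ≈⟨ -‿cong (-‿distribʳ-* x x) ⟨
    - (- (x * x))  ≈⟨ -‿involutive (x * x) ⟩
    x * x          ∎

  0<1 : 0# < 1#
  0<1 = <-respʳ-≈ (*-identityʳ 1#) (square-positive (0≉1 ∘ sym))

  positive-inverse : ∀ {x} → 0# < x → ∃ λ y → 0# < y × x * y ≈ 1#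
  positive-inverse {x} 0<x with inverse x (λ x≈0 → irrefl (sym x≈0) 0<x)
  ... | y , xy≈1 with compare y 0#
  ... | tri> _ _ 0<y = y , 0<y , xy≈1
  ... | tri≈ _ y≈0 _ = contradiction
    (trans (sym (zeroʳ x)) (trans (*-congˡ (sym y≈0)) xy≈1)) 0≉1
  ... | tri< y<0 _ _ = contradiction
    (<-respˡ-≈ xy≈1 (pos*neg⇒neg 0<x y<0)) (asym 0<1)

  *-cancelʳ-nonzero : ∀ {x y z} → ¬ z ≈ 0# → x * z ≈ y * z → x ≈ y
  *-cancelʳ-nonzero {x} {y} {z} z≉0 xz≈yz with inverse z z≉0
  ... | w , zw≈1 = begin-equality
    x            ≈⟨ *-identityʳ x ⟨
    x * 1#       ≈⟨ *-congˡ zw≈1 ⟨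
    x * (z * w)  ≈⟨ *-assoc x z w ⟨
    x * z * w    ≈⟨ *-congʳ xz≈yz ⟩
    y * z * w    ≈⟨ *-assoc y z w ⟩
    y * (z * w)  ≈⟨ *-congˡ zw≈1 ⟩
    y * 1#       ≈⟨ *-identityʳ y ⟩
    y            ∎

  fromℕ-nonneg : ∀ m → 0# ≤ fromℕ m
  fromℕ-nonneg zero    = inj₂ ≈-refl
  fromℕ-nonneg (suc m) = inj₁ (begin-strict
    0#            ≤⟨ fromℕ-nonneg m ⟩
    fromℕ m       ≈⟨ +-identityˡ (fromℕ m) ⟨
    0# + fromℕ m  <⟨ +-monoˡ-< (fromℕ m) 0<1 ⟩
    1# + fromℕ m  ∎)

  0≉fromℕ-suc : ∀ m → ¬ 0# ≈ fromℕ (suc m)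
  0≉fromℕ-suc m 0≈1+m = irrefl 0≈1+m (begin-strict
    0#            ≤⟨ fromℕ-nonneg m ⟩
    fromℕ m       ≈⟨ +-identityˡ (fromℕ m) ⟨
    0# + fromℕ m  <⟨ +-monoˡ-< (fromℕ m) 0<1 ⟩
    1# + fromℕ m  ∎)

  -- An ordered field has characteristic 0. This is what allows the real values output at a leaf to
  -- be read back as positions.
  fromℕ-injective : ∀ {k m} → fromℕ k ≈ fromℕ m → k ≡ m
  fromℕ-injective {zero}  {zero}  _  = refl
  fromℕ-injective {zero}  {suc m} eq = contradiction eq (0≉fromℕ-suc m)
  fromℕ-injective {suc k} {zero}  eq = contradiction (sym eq) (0≉fromℕ-suc k)
  fromℕ-injective {suc k} {suc m} eq =
    cong suc (fromℕ-injective (+-cancelˡ 1# _ _ eq))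

-- Univariate polynomials and their signs just to the right of 0.

module UnivariatePolynomials (ℝ : CompleteOrderedField) where

  open CompleteOrderedField ℝ renaming (refl to ≈-refl; zero to *-zero)
  open OrderedFieldProperties ℝ
  open import Algebra.Solver.Ring.NaturalCoefficients.Default
    commutativeSemiring using (solve; _:=_; _:+_; _:*_)
  open import Algebra.Properties.Semiring.Exp semiring using (_^_)
  open import Relation.Binary.Reasoning.StrictPartialOrder
    (StrictTotalOrder.strictPartialOrder strictTotalOrder)

  -- The closed upper end makes δ itself a point where S holds.
  Eventually : (Carrier → Set) → Set
  Eventually S = ∃ λ δ → 0# < δ × (∀ ε → 0# < ε → ε ≤ δ → S ε)

  Eventually-always : ∀ {S} → (∀ ε → S ε) → Eventually S
  Eventually-always s = 1# , 0<1 , λ ε _ _ → s ε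

  Eventually-map : ∀ {S T} → (∀ {ε} → S ε → T ε) → Eventually S → Eventually T
  Eventually-map f (δ , 0<δ , s) = δ , 0<δ , λ ε 0<ε ε≤δ → f (s ε 0<ε ε≤δ)

  Eventually-witness : ∀ {S} → Eventually S → ∃ S
  Eventually-witness (δ , 0<δ , s) = δ , s δ 0<δ (inj₂ ≈-refl)

  Eventually-zip : ∀ {S T U} → (∀ {ε} → S ε → T ε → U ε) →
                   Eventually S → Eventually T → Eventually U
  Eventually-zip f (δ , 0<δ , s) (η , 0<η , t) with compare δ η
  ... | tri< δ<η _ _ = δ , 0<δ , λ ε 0<ε ε≤δ →
    f (s ε 0<ε ε≤δ) (t ε 0<ε (≤-trans ε≤δ (inj₁ δ<η)))
  ... | tri≈ _ δ≈η _ = δ , 0<δ , λ ε 0<ε ε≤δ →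
    f (s ε 0<ε ε≤δ) (t ε 0<ε (≤-trans ε≤δ (inj₂ δ≈η)))
  ... | tri> _ _ η<δ = η , 0<η , λ ε 0<ε ε≤η →
    f (s ε 0<ε (≤-trans ε≤η (inj₁ η<δ))) (t ε 0<ε ε≤η)

  Eventually-∩ : ∀ {S T} → Eventually S → Eventually T →
                 Eventually (λ ε → S ε × T ε)
  Eventually-∩ = Eventually-zip _,_

  eventually-≤ : ∀ {δ} → 0# < δ → Eventually (_≤ δ)
  eventually-≤ {δ} 0<δ = δ , 0<δ , λ _ _ ε≤δ → ε≤δ

  eventually-pos : Eventually (0# <_)
  eventually-pos = 1# , 0<1 , λ _ 0<ε _ → 0<ε

  Eventually-All : ∀ {A : Set} {S : A → Carrier → Set} {xs : List A} →
                   All (λ x → Eventually (S x)) xs →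
                   Eventually (λ ε → All (λ x → S x ε) xs)
  Eventually-All []       = Eventually-always (λ _ → [])
  Eventually-All (s ∷ ss) = Eventually-zip _∷_ s (Eventually-All ss)

  Eventually-∀ : ∀ {n} {S : Fin n → Carrier → Set} →
                 (∀ i → Eventually (S i)) → Eventually (λ ε → ∀ i → S i ε)
  Eventually-∀ {n} s = Eventually-map
    (λ all i → All.lookup all (∈-allFin i))
    (Eventually-All (All.tabulate {xs = allFin n} λ {i} _ → s i))

  -- Coefficients in ascending order of degree.
  UPoly : Set
  UPoly = List Carrier

  ⟦_⟧ : UPoly → Carrier → Carrier
  ⟦ []     ⟧ x = 0#
  ⟦ c ∷ cs ⟧ x = c + x * ⟦ cs ⟧ x

  infixl 6 _⊞_
  infixl 7 _⊠_ _⊡_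
  infixr 8 _⊠^_

  _⊞_ : UPoly → UPoly → UPoly
  []       ⊞ ds       = ds
  (c ∷ cs) ⊞ []       = c ∷ cs
  (c ∷ cs) ⊞ (d ∷ ds) = (c + d) ∷ (cs ⊞ ds)

  _⊡_ : Carrier → UPoly → UPoly
  a ⊡ cs = map (a *_) cs

  _⊠_ : UPoly → UPoly → UPoly
  []       ⊠ ds = []
  (c ∷ cs) ⊠ ds = c ⊡ ds ⊞ (0# ∷ (cs ⊠ ds))

  _⊠^_ : UPoly → ℕ → UPoly
  cs ⊠^ zero  = [ 1# ]
  cs ⊠^ suc m = cs ⊠ cs ⊠^ m

  ⟦⟧-homo-+ : ∀ cs ds x → ⟦ cs ⊞ ds ⟧ x ≈ ⟦ cs ⟧ x + ⟦ ds ⟧ x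
  ⟦⟧-homo-+ []       ds       x = sym (+-identityˡ _)
  ⟦⟧-homo-+ (c ∷ cs) []       x = sym (+-identityʳ _)
  ⟦⟧-homo-+ (c ∷ cs) (d ∷ ds) x = begin-equality
    (c + d) + x * ⟦ cs ⊞ ds ⟧ x
      ≈⟨ +-congˡ (*-congˡ (⟦⟧-homo-+ cs ds x)) ⟩
    (c + d) + x * (⟦ cs ⟧ x + ⟦ ds ⟧ x)
      ≈⟨ solve 5 (λ c d x u v →
           (c :+ d) :+ x :* (u :+ v) := (c :+ x :* u) :+ (d :+ x :* v))
           ≈-refl c d x (⟦ cs ⟧ x) (⟦ ds ⟧ x) ⟩
    (c + x * ⟦ cs ⟧ x) + (d + x * ⟦ ds ⟧ x)  ∎

  ⟦⟧-homo-⊡ : ∀ a cs x → ⟦ a ⊡ cs ⟧ x ≈ a * ⟦ cs ⟧ x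
  ⟦⟧-homo-⊡ a []       x = sym (zeroʳ a)
  ⟦⟧-homo-⊡ a (c ∷ cs) x = begin-equality
    a * c + x * ⟦ a ⊡ cs ⟧ x    ≈⟨ +-congˡ (*-congˡ (⟦⟧-homo-⊡ a cs x)) ⟩
    a * c + x * (a * ⟦ cs ⟧ x)
      ≈⟨ solve 4 (λ a c x u → a :* c :+ x :* (a :* u) := a :* (c :+ x :* u))
           ≈-refl a c x (⟦ cs ⟧ x) ⟩
    a * (c + x * ⟦ cs ⟧ x)      ∎

  ⟦⟧-homo-* : ∀ cs ds x → ⟦ cs ⊠ ds ⟧ x ≈ ⟦ cs ⟧ x * ⟦ ds ⟧ x
  ⟦⟧-homo-* []       ds x = sym (zeroˡ _)
  ⟦⟧-homo-* (c ∷ cs) ds x = begin-equality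
    ⟦ c ⊡ ds ⊞ (0# ∷ (cs ⊠ ds)) ⟧ x
      ≈⟨ ⟦⟧-homo-+ (c ⊡ ds) (0# ∷ (cs ⊠ ds)) x ⟩
    ⟦ c ⊡ ds ⟧ x + (0# + x * ⟦ cs ⊠ ds ⟧ x)
      ≈⟨ +-cong (⟦⟧-homo-⊡ c ds x)
           (trans (+-identityˡ _) (*-congˡ (⟦⟧-homo-* cs ds x))) ⟩
    c * ⟦ ds ⟧ x + x * (⟦ cs ⟧ x * ⟦ ds ⟧ x)
      ≈⟨ solve 4 (λ c x u v → c :* v :+ x :* (u :* v) := (c :+ x :* u) :* v)
           ≈-refl c x (⟦ cs ⟧ x) (⟦ ds ⟧ x) ⟩
    (c + x * ⟦ cs ⟧ x) * ⟦ ds ⟧ x  ∎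

  ⟦constant⟧ : ∀ c x → ⟦ [ c ] ⟧ x ≈ c
  ⟦constant⟧ c x = trans (+-congˡ (zeroʳ x)) (+-identityʳ c)

  ⟦⟧-homo-^ : ∀ cs m x → ⟦ cs ⊠^ m ⟧ x ≈ ⟦ cs ⟧ x ^ m
  ⟦⟧-homo-^ cs zero    x = ⟦constant⟧ 1# x
  ⟦⟧-homo-^ cs (suc m) x =
    trans (⟦⟧-homo-* cs (cs ⊠^ m) x) (*-congˡ (⟦⟧-homo-^ cs m x))

  ⟦⟧-homo-minus : ∀ cs ds x → ⟦ cs ⊞ (- 1#) ⊡ ds ⟧ x ≈ ⟦ cs ⟧ x - ⟦ ds ⟧ x
  ⟦⟧-homo-minus cs ds x = trans (⟦⟧-homo-+ cs ((- 1#) ⊡ ds) x)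
    (+-congˡ (trans (⟦⟧-homo-⊡ (- 1#) ds x) (-1*x≈-x _)))

  -- Induction along Horner's scheme. Keeping `M` positive gives `ε * M ≤ M` on (0, 1], so a further
  -- coefficient `c` raises the bound to `c + M` if it is positive and leaves it at `M` otherwise.
  bounded-above : ∀ cs → ∃ λ M → 0# < M ×
                  (∀ ε → 0# < ε → ε ≤ 1# → ⟦ cs ⟧ ε < M)
  bounded-above []       = 1# , 0<1 , λ _ _ _ → 0<1
  bounded-above (c ∷ cs) with bounded-above cs
  ... | M , 0<M , ⟦cs⟧<M = bound (compare c 0#)
    where
    ε⟦cs⟧<M : ∀ ε → 0# < ε → ε ≤ 1# → ε * ⟦ cs ⟧ ε < M
    ε⟦cs⟧<M ε 0<ε ε≤1 = begin-strict
      ε * ⟦ cs ⟧ ε  <⟨ *-monoʳ-< 0<ε (⟦cs⟧<M ε 0<ε ε≤1) ⟩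
      ε * M         ≤⟨ εM≤M ε≤1 ⟩
      M             ∎
      where
      εM≤M : ε ≤ 1# → ε * M ≤ M
      εM≤M (inj₁ ε<1) = inj₁ (begin-strict
        ε * M   ≈⟨ *-comm ε M ⟩
        M * ε   <⟨ *-monoʳ-< 0<M ε<1 ⟩
        M * 1#  ≈⟨ *-identityʳ M ⟩
        M       ∎)
      εM≤M (inj₂ ε≈1) = inj₂ (trans (*-congʳ ε≈1) (*-identityˡ M))

    bound : Tri (c < 0#) (c ≈ 0#) (0# < c) →
            ∃ λ M′ → 0# < M′ × (∀ ε → 0# < ε → ε ≤ 1# → c + ε * ⟦ cs ⟧ ε < M′)
    bound (tri< c<0 _ _) = M , 0<M , λ ε 0<ε ε≤1 → begin-strict
      c + ε * ⟦ cs ⟧ ε   <⟨ +-monoˡ-< _ c<0 ⟩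
      0# + ε * ⟦ cs ⟧ ε  ≈⟨ +-identityˡ _ ⟩
      ε * ⟦ cs ⟧ ε       <⟨ ε⟦cs⟧<M ε 0<ε ε≤1 ⟩
      M                  ∎
    bound (tri≈ _ c≈0 _) = M , 0<M , λ ε 0<ε ε≤1 → begin-strict
      c + ε * ⟦ cs ⟧ ε   ≈⟨ +-congʳ c≈0 ⟩
      0# + ε * ⟦ cs ⟧ ε  ≈⟨ +-identityˡ _ ⟩
      ε * ⟦ cs ⟧ ε       <⟨ ε⟦cs⟧<M ε 0<ε ε≤1 ⟩
      M                  ∎
    bound (tri> _ _ 0<c) = c + M ,
      (begin-strict
        0#      <⟨ 0<M ⟩
        M       ≈⟨ +-identityˡ M ⟨
        0# + M  <⟨ +-monoˡ-< M 0<c ⟩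
        c + M   ∎) ,
      λ ε 0<ε ε≤1 → +-monoʳ-< c (ε⟦cs⟧<M ε 0<ε ε≤1)

  -- The constant term dominates: with `M` bounding the tail, every positive ε up to both 1 and -c/M
  -- satisfies ε · tail < ε · M ≤ -c.
  eventually-neg-cons : ∀ {c} cs → c < 0# → Eventually (λ ε → ⟦ c ∷ cs ⟧ ε < 0#)
  eventually-neg-cons {c} cs c<0 with bounded-above cs
  ... | M , 0<M , ⟦cs⟧<M with positive-inverse 0<M
  -- `w` is 1/M, so the threshold `- c * w` below is -c/M.
  ... | w , 0<w , Mw≈1 = Eventually-map negative
          (Eventually-∩ eventually-pos (Eventually-∩ (eventually-≤ 0<1)
            (eventually-≤ (*-positive (neg⇒-pos c<0) 0<w))))
    where
    εM≤-c : ∀ {ε} → ε ≤ - c * w → ε * M ≤ - c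
    εM≤-c {ε} ε≤-cw = begin
      ε * M          ≈⟨ *-comm ε M ⟩
      M * ε          ≤⟨ M*-mono ε≤-cw ⟩
      M * (- c * w)  ≈⟨ solve 3 (λ c w M → M :* (c :* w) := c :* (M :* w))
                          ≈-refl (- c) w M ⟩
      - c * (M * w)  ≈⟨ *-congˡ Mw≈1 ⟩
      - c * 1#       ≈⟨ *-identityʳ (- c) ⟩
      - c            ∎
      where
      M*-mono : ∀ {x y} → x ≤ y → M * x ≤ M * y
      M*-mono (inj₁ x<y) = inj₁ (*-monoʳ-< 0<M x<y)
      M*-mono (inj₂ x≈y) = inj₂ (*-congˡ x≈y)

    negative : ∀ {ε} → 0# < ε × ε ≤ 1# × ε ≤ - c * w → ⟦ c ∷ cs ⟧ ε < 0#
    negative {ε} (0<ε , ε≤1 , ε≤-cw) = begin-strict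
      c + ε * ⟦ cs ⟧ ε  <⟨ +-monoʳ-< c (begin-strict
        ε * ⟦ cs ⟧ ε       <⟨ *-monoʳ-< 0<ε (⟦cs⟧<M ε 0<ε ε≤1) ⟩
        ε * M              ≤⟨ εM≤-c ε≤-cw ⟩
        - c                ∎) ⟩
      c + - c           ≈⟨ -‿inverseʳ c ⟩
      0#                ∎

  -1⊡-neg⇒pos : ∀ cs {ε} → ⟦ (- 1#) ⊡ cs ⟧ ε < 0# → 0# < ⟦ cs ⟧ ε
  -1⊡-neg⇒pos cs {ε} neg = begin-strict
    0#                      <⟨ neg⇒-pos neg ⟩
    - ⟦ (- 1#) ⊡ cs ⟧ ε     ≈⟨ -‿cong (trans (⟦⟧-homo-⊡ (- 1#) cs ε) (-1*x≈-x _)) ⟩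
    - - ⟦ cs ⟧ ε            ≈⟨ -‿involutive _ ⟩
    ⟦ cs ⟧ ε                ∎

  eventually-pos-cons : ∀ {c} cs → 0# < c → Eventually (λ ε → 0# < ⟦ c ∷ cs ⟧ ε)
  eventually-pos-cons {c} cs 0<c = Eventually-map (-1⊡-neg⇒pos (c ∷ cs))
    (eventually-neg-cons ((- 1#) ⊡ cs)
      (<-respˡ-≈ (sym (-1*x≈-x c)) (pos⇒-neg 0<c)))

  -- One-sided continuity at 0 in the form needed for strict inequalities: the value at 0 is the
  -- constant coefficient, whose sign persists.
  positive-near-0 : ∀ cs → 0# < ⟦ cs ⟧ 0# → Eventually (λ ε → 0# < ⟦ cs ⟧ ε)
  positive-near-0 []       0<0 = contradiction 0<0 (irrefl ≈-refl)
  positive-near-0 (c ∷ cs) 0<c = eventually-pos-cons cs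
    (<-respʳ-≈ (trans (+-congˡ (zeroˡ _)) (+-identityʳ c)) 0<c)

  data EventualSign (cs : UPoly) : Set where
    null     : (∀ ε → ⟦ cs ⟧ ε ≈ 0#) → EventualSign cs
    negative : Eventually (λ ε → ⟦ cs ⟧ ε < 0#) → EventualSign cs
    positive : Eventually (λ ε → 0# < ⟦ cs ⟧ ε) → EventualSign cs

  -- The lowest nonzero coefficient decides. While the constant term is zero, the value is ε times
  -- that of the tail, and a factor ε > 0 preserves signs. If no coefficient is left, the polynomial
  -- vanishes everywhere and not only near 0.
  eventualSign : ∀ cs → EventualSign cs
  eventualSign []       = null (λ _ → ≈-refl)
  eventualSign (c ∷ cs) with compare c 0# | eventualSign cs
  ... | tri< c<0 _ _ | _ = negative (eventually-neg-cons cs c<0)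
  ... | tri> _ _ 0<c | _ = positive (eventually-pos-cons cs 0<c)
  ... | tri≈ _ c≈0 _ | null z = null λ ε →
    trans (+-cong c≈0 (trans (*-congˡ (z ε)) (zeroʳ ε))) (+-identityʳ 0#)
  ... | tri≈ _ c≈0 _ | negative s = negative (Eventually-zip
    (λ 0<ε neg → <-respˡ-≈ (sym (trans (+-congʳ c≈0) (+-identityˡ _)))
                   (pos*neg⇒neg 0<ε neg))
    eventually-pos s)
  ... | tri≈ _ c≈0 _ | positive s = positive (Eventually-zip
    (λ 0<ε pos → <-respʳ-≈ (sym (trans (+-congʳ c≈0) (+-identityˡ _)))
                   (*-positive 0<ε pos))
    eventually-pos s)

  eventually-nonzero : ∀ cs {x} → ¬ ⟦ cs ⟧ x ≈ 0# →
                       Eventually (λ ε → ¬ ⟦ cs ⟧ ε ≈ 0#)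
  eventually-nonzero cs {x} nz with eventualSign cs
  ... | null z     = contradiction (z x) nz
  ... | negative s = Eventually-map (λ neg z → irrefl z neg) s
  ... | positive s = Eventually-map (λ pos z → irrefl (sym z) pos) s

  -- Replaces the counting of roots: a nonzero value at any `x` rules out the case `null` of
  -- `eventualSign`, so the polynomial would be nonzero at all small ε > 0, where it is also zero.
  eventually-zero⇒zero : ∀ cs → Eventually (λ ε → ⟦ cs ⟧ ε ≈ 0#) →
                         ∀ x → ⟦ cs ⟧ x ≈ 0#
  eventually-zero⇒zero cs ez x with ⟦ cs ⟧ x ≟ 0#
  ... | yes z = z
  ... | no nz with Eventually-witness (Eventually-∩ ez (eventually-nonzero cs nz))
  ... | _ , z , ¬z = contradiction z ¬z

-- A pigeonhole principle for lists.

module Counting where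

  lookup-injective : ∀ {A : Set} {xs : List A} → Unique xs →
                     ∀ i j → List.lookup xs i ≡ List.lookup xs j → i ≡ j
  lookup-injective (x≢ ∷ _) Fin.zero    Fin.zero    _  = refl
  lookup-injective (x≢ ∷ _) Fin.zero    (Fin.suc j) eq =
    contradiction eq (All.lookup x≢ (∈-lookup j))
  lookup-injective (x≢ ∷ _) (Fin.suc i) Fin.zero    eq =
    contradiction (≡.sym eq) (All.lookup x≢ (∈-lookup i))
  lookup-injective (_ ∷ u)  (Fin.suc i) (Fin.suc j) eq =
    cong Fin.suc (lookup-injective u i j eq)

  -- Each x is sent to the position of a chosen related y. Working with positions avoids deciding
  -- equality on `B` and permits repetitions in `ys`.
  length-≤ : ∀ {A B : Set} {R : A → B → Set} {xs : List A} {ys : List B} →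
             (∀ {x x′ y} → R x y → R x′ y → x ≡ x′) → Unique xs →
             All (λ x → ∃ λ y → y ∈ ys × R x y) xs → length xs ℕ.≤ length ys
  length-≤ {R = R} {xs} {ys} R-injective unique related =
    injective⇒≤ {f = position} λ {i} {j} → position-injective i j
    where
    image : ∀ i → ∃ λ y → y ∈ ys × R (List.lookup xs i) y
    image i = All.lookup related (∈-lookup i)

    position : Fin (length xs) → Fin (length ys)
    position i = Any.index (proj₁ (proj₂ (image i)))

    position-injective : ∀ i j → position i ≡ position j → i ≡ j
    position-injective i j eq with image i | image j
    ... | y , y∈ys , Rxy | y′ , y′∈ys , Rxy′
      -- Equal positions in `ys` hold the same element, so both x are related to one y.
      with refl ← Membership.index-injective (≡.setoid _) y∈ys y′∈ys eq =
      lookup-injective unique i j (R-injective Rxy Rxy′)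

-- Polynomial curves and the restriction of multivariate polynomials to them.

module LowerBound (ℝ : CompleteOrderedField) where

  open CompleteOrderedField ℝ renaming (refl to ≈-refl; zero to *-zero)
  open OrderedFieldProperties ℝ
  open UnivariatePolynomials ℝ
  open MCSP ℝ
  open RationalFunction
  open Counting
  open import Algebra.Properties.Semiring.Exp semiring using (_^_; ^-congˡ)
  open import Relation.Binary.Reasoning.StrictPartialOrder
    (StrictTotalOrder.strictPartialOrder strictTotalOrder)

  Curve : ℕ → Set
  Curve n = Vec UPoly n

  -- Up to ≈ only, so that a line passes through the very A and C that span it.
  At : ∀ {n} → Carrier → Curve n → Sequence n → Set
  At x = VecPointwise (λ cs b → b ≈ ⟦ cs ⟧ x)

  point : ∀ {n} → Curve n → Carrier → Sequence n
  point X x = Vec.map (λ cs → ⟦ cs ⟧ x) X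

  point-At : ∀ {n} x (X : Curve n) → At x X (point X x)
  point-At x []       = []ᵛ
  point-At x (cs ∷ X) = ≈-refl ∷ᵛ point-At x X

  line : ∀ {n} → Sequence n → Sequence n → Curve n
  line = zipWith (λ a c → a ∷ c - a ∷ [])

  line-0 : ∀ {n} (A C : Sequence n) → At 0# (line A C) A
  line-0 []      []      = []ᵛ
  line-0 (a ∷ A) (c ∷ C) =
    sym (trans (+-congˡ (zeroˡ _)) (+-identityʳ a)) ∷ᵛ line-0 A C

  line-1 : ∀ {n} (A C : Sequence n) → At 1# (line A C) C
  line-1 []      []      = []ᵛ
  line-1 (a ∷ A) (c ∷ C) = (begin-equality
    c                 ≈⟨ //-rightDividesˡ a c ⟨
    (c - a) + a       ≈⟨ +-comm (c - a) a ⟩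
    a + (c - a)       ≈⟨ +-congˡ (trans (*-identityˡ _) (⟦constant⟧ (c - a) 1#)) ⟨
    a + 1# * ⟦ [ c - a ] ⟧ 1#  ∎) ∷ᵛ line-1 A C

  restrictMonomial : ∀ {n} → Monomial n → Curve n → UPoly
  restrictMonomial (c , e) X = c ⊡ foldr′ _⊠_ [ 1# ] (zipWith _⊠^_ X e)

  restrict : ∀ {n} → Polynomial n → Curve n → UPoly
  restrict p X = foldr (λ m s → restrictMonomial m X ⊞ s) [] p

  evalMonomial-restrict : ∀ {n} (m : Monomial n) {X A x} → At x X A →
                          evalMonomial m A ≈ ⟦ restrictMonomial m X ⟧ x
  evalMonomial-restrict (c , e) {X} {x = x} at =
    trans (*-congˡ (powers e at))
      (sym (⟦⟧-homo-⊡ c (foldr′ _⊠_ [ 1# ] (zipWith _⊠^_ X e)) x))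
    where
    powers : ∀ {n} (e : Vec ℕ n) {X A} → At x X A →
             foldr′ _*_ 1# (zipWith _^_ A e) ≈
             ⟦ foldr′ _⊠_ [ 1# ] (zipWith _⊠^_ X e) ⟧ x
    powers []      []ᵛ       = sym (⟦constant⟧ 1# x)
    powers (k ∷ e) (_∷ᵛ_ {x = cs} a≈ at) = trans
      (*-cong (trans (^-congˡ k a≈) (sym (⟦⟧-homo-^ cs k x))) (powers e at))
      (sym (⟦⟧-homo-* (cs ⊠^ k) _ x))

  eval-restrict : ∀ {n} (p : Polynomial n) {X A x} → At x X A →
                  eval p A ≈ ⟦ restrict p X ⟧ x
  eval-restrict []      at = ≈-refl
  eval-restrict (m ∷ p) {X} {x = x} at = trans
    (+-cong (evalMonomial-restrict m at) (eval-restrict p at))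
    (sym (⟦⟧-homo-+ (restrictMonomial m X) _ x))

  -- The parameter `x` is arbitrary: one point of the curve where `p` is nonzero, however far from
  -- 0, keeps its restriction from being the zero polynomial.
  eventually-nonzero-on : ∀ {n} (p : Polynomial n) (X : Curve n) {x A} →
    At x X A → ¬ eval p A ≈ 0# → Eventually (λ ε → ¬ eval p (point X ε) ≈ 0#)
  eventually-nonzero-on p X at nz = Eventually-map
    (λ nz′ z → nz′ (trans (sym (eval-restrict p (point-At _ X))) z))
    (eventually-nonzero (restrict p X)
      (λ z → nz (trans (eval-restrict p at) z)))

  -- Let `C` suit `fs` and let `A` be a point where the denominator of `f` is nonzero. On the line
  -- from `C` to `A` each denominator is nonzero at one end, hence at all small ε > 0, and finitely
  -- many such conditions hold at a common ε.
  generic-point : ∀ {n} (fs : List (RationalFunction n)) →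
                  ∃ λ C → All (λ f → ¬ eval (denominator f) C ≈ 0#) fs
  generic-point []       = Vec.replicate _ 0# , []
  generic-point (f ∷ fs) with nonzero f | generic-point fs
  ... | A , nz | C , nzs with Eventually-witness (Eventually-All
    (eventually-nonzero-on (denominator f) (line C A) (line-1 C A) nz
     ∷ All.map (λ {g} → eventually-nonzero-on (denominator g) (line C A)
                          (line-0 C A)) nzs))
  ... | ε , nzs′ = point (line C A) ε , nzs′

  -- Window sums along a curve and the persistence of a unique output.

  windowPoly : ∀ {n} → Curve n → (p ℓ : ℕ) → UPoly
  windowPoly X p ℓ = foldr _⊞_ [] (take ℓ (drop (p ∸ 1) (toList X)))

  windowSum-restrict : ∀ {n} {X : Curve n} {A x} p ℓ → At x X A →
                       windowSum A p ℓ ≈ ⟦ windowPoly X p ℓ ⟧ x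
  windowSum-restrict {x = x} p ℓ at = sums (takes ℓ (drops (p ∸ 1) (toLists at)))
    where
    _∼_ : UPoly → Carrier → Set
    cs ∼ b = b ≈ ⟦ cs ⟧ x

    toLists : ∀ {n} {X : Curve n} {A} → At x X A →
              Pointwise _∼_ (toList X) (toList A)
    toLists []ᵛ       = []
    toLists (a ∷ᵛ at) = a ∷ toLists at

    drops : ∀ k {xs ys} → Pointwise _∼_ xs ys →
            Pointwise _∼_ (drop k xs) (drop k ys)
    drops zero    rs       = rs
    drops (suc k) []       = []
    drops (suc k) (_ ∷ rs) = drops k rs

    takes : ∀ k {xs ys} → Pointwise _∼_ xs ys →
            Pointwise _∼_ (take k xs) (take k ys)
    takes zero    rs       = []
    takes (suc k) []       = []
    takes (suc k) (r ∷ rs) = r ∷ takes k rs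

    sums : ∀ {xs ys} → Pointwise _∼_ xs ys →
           foldr _+_ 0# ys ≈ ⟦ foldr _⊞_ [] xs ⟧ x
    sums []              = ≈-refl
    sums (_∷_ {x = cs} r rs) = trans (+-cong r (sums rs))
      (sym (⟦⟧-homo-+ cs _ x))

  Beats : ∀ {n} → Sequence n → (p q ℓ : ℕ) → Set
  Beats A p q ℓ = windowSum A q ℓ < windowSum A p ℓ

  -- Along the curve the difference of the two window sums is a polynomial in ε, positive at 0.
  eventually-beats : ∀ {n} {X : Curve n} {A} p q ℓ → At 0# X A →
                     Beats A p q ℓ → Eventually (λ ε → Beats (point X ε) p q ℓ)
  eventually-beats {X = X} {A} p q ℓ at beats = Eventually-map
    (λ {ε} 0<d → 0<y-x⇒x<y (<-respʳ-≈ (sym (difference (point-At ε X))) 0<d))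
    (positive-near-0 d (<-respʳ-≈ (difference at) (x<y⇒0<y-x beats)))
    where
    d : UPoly
    d = windowPoly X p ℓ ⊞ (- 1#) ⊡ windowPoly X q ℓ

    difference : ∀ {x B} → At x X B → windowSum B p ℓ - windowSum B q ℓ ≈ ⟦ d ⟧ x
    difference {x} at = trans
      (+-cong (windowSum-restrict p ℓ at) (-‿cong (windowSum-restrict q ℓ at)))
      (sym (⟦⟧-homo-minus (windowPoly X p ℓ) (windowPoly X q ℓ) x))

  vec-≡ : ∀ {A : Set} {n} {xs ys : Vec A n} →
          (∀ i → lookup xs i ≡ lookup ys i) → xs ≡ ys
  vec-≡ = Pointwise-≡⇒≡ ∘ ext

  -- Replacing one entry of an output configuration by another optimal start
  -- yields an output configuration.
  unique-strict : ∀ {n} {A : Sequence n} {P} →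
    (∀ Q → IsOutputConfiguration A Q → Q ≡ P) → IsOutputConfiguration A P →
    ∀ i q → IsStart n (suc (toℕ i)) q → q ≢ lookup P i →
    Beats A (lookup P i) q (suc (toℕ i))
  unique-strict {n} {A} {P} unique (isConf , isMax) i q q-start q≢ =
    tie-impossible (isMax i q q-start)
    where
    tie-impossible : windowSum A q (suc (toℕ i)) ≤
                     windowSum A (lookup P i) (suc (toℕ i)) →
             Beats A (lookup P i) q (suc (toℕ i))
    tie-impossible (inj₁ q<P) = q<P
    tie-impossible (inj₂ q≈P) = contradiction
      (≡.trans (≡.sym (lookup∘update i P q))
        (cong (λ Q → lookup Q i) (unique (P [ i ]≔ q) (isConf′ , isMax′))))
      q≢
      where
      isConf′ : IsConfiguration (P [ i ]≔ q)
      isConf′ j with j ≟ᶠ i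
      ... | yes refl rewrite lookup∘update i P q = q-start
      ... | no j≢i rewrite lookup∘update′ j≢i P q = isConf j

      isMax′ : ∀ j r → IsStart n (suc (toℕ j)) r →
               windowSum A r (suc (toℕ j)) ≤
               windowSum A (lookup (P [ i ]≔ q) j) (suc (toℕ j))
      isMax′ j r r-start with j ≟ᶠ i
      ... | yes refl rewrite lookup∘update i P q =
        ≤-trans (isMax i r r-start) (inj₂ (sym q≈P))
      ... | no j≢i rewrite lookup∘update′ j≢i P q = isMax j r r-start

  -- Being the only output at `A` amounts to finitely many strict inequalities, one for each length
  -- and each competing start, and these survive together for small ε. That some output exists near
  -- `A` is supplied later by the tree.
  eventually-unique : ∀ {n} {A : Sequence n} {P X} → At 0# X A →
    (∀ Q → IsOutputConfiguration A Q → Q ≡ P) → IsOutputConfiguration A P →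
    Eventually (λ ε → ∀ Q → IsOutputConfiguration (point X ε) Q → Q ≡ P)
  eventually-unique {n} {A} {P} {X} at unique output = Eventually-map
    (λ {ε} beats Q output′ → vec-≡ (agree beats Q output′))
    (Eventually-∀ λ i → Eventually-∀ λ k → beat i k)
    where
    -- The number of admissible starts for the length of index `i`. Starts are 1-based, so
    -- `k : Fin (starts i)` encodes the start `suc (toℕ k)`.
    starts : Fin n → ℕ
    starts i = n ∸ suc (toℕ i) ℕ.+ 1

    StrictAt : ∀ i (k : Fin (starts i)) → Carrier → Set
    StrictAt i k ε = suc (toℕ k) ≢ lookup P i →
      Beats (point X ε) (lookup P i) (suc (toℕ k)) (suc (toℕ i))

    beat : ∀ i k → Eventually (StrictAt i k)
    beat i k with suc (toℕ k) ℕ.≟ lookup P i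
    ... | yes k≡ = Eventually-always (λ _ k≢ → contradiction k≡ k≢)
    ... | no k≢ = Eventually-map (λ b _ → b)
      (eventually-beats (lookup P i) (suc (toℕ k)) (suc (toℕ i)) at
        (unique-strict unique output i (suc (toℕ k)) (s≤s z≤n , toℕ<n k) k≢))

    agree : ∀ {ε} → (∀ i k → StrictAt i k ε) → ∀ Q →
            IsOutputConfiguration (point X ε) Q → ∀ i → lookup Q i ≡ lookup P i
    agree {ε} beats Q (isConf , isMax) i with lookup Q i in Qi≡ | isConf i
    -- A start is at least 1, hence of the form `suc q`, and its upper bound `suc q ≤ starts i` is
    -- by definition `q < starts i`. If it differs from the start in `P`, the latter beats it,
    -- against the maximality of `Q`.
    ... | suc q | _ , q<starts with suc q ℕ.≟ lookup P i
    ... | yes eq = eq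
    ... | no q≢ = contradiction
      (subst (λ r → r ≢ lookup P i →
                Beats (point X ε) (lookup P i) r (suc (toℕ i)))
        (cong suc (toℕ-fromℕ< q<starts)) (beats i (fromℕ< q<starts)) q≢)
      (≤⇒≯ (subst (λ r → windowSum (point X ε) (lookup P i) (suc (toℕ i)) ≤
                         windowSum (point X ε) r (suc (toℕ i))) Qi≡
             (isMax i (lookup P i) (proj₁ output i))))

  -- Decision trees followed along a curve.

  leaves : ∀ {n} → DecisionTree n → List (Vec (RationalFunction n) n)
  leaves (leaf g)          = [ g ]
  leaves (node _ t₋ t₀ t₊) = leaves t₋ ++ leaves t₀ ++ leaves t₊

  length-leaves : ∀ {n} (t : DecisionTree n) →
                  length (leaves t) ℕ.≤ 3 ℕ.^ height t
  length-leaves (leaf g) = ℕ.≤-refl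
  length-leaves (node f t₋ t₀ t₊)
    rewrite length-++ (leaves t₋) {leaves t₀ ++ leaves t₊}
          | length-++ (leaves t₀) {leaves t₊}
          -- `3 ^ suc h` unfolds to a sum of three copies of `3 ^ h` with a trailing `+ 0`, which
          -- this removes; each subtree then pays for one copy.
          | ℕ.+-identityʳ (3 ℕ.^ (height t₋ ⊔ height t₀ ⊔ height t₊)) =
    ℕ.+-mono-≤ (bound t₋ (ℕ.≤-trans (ℕ.m≤m⊔n _ (height t₀)) (ℕ.m≤m⊔n _ _)))
      (ℕ.+-mono-≤ (bound t₀ (ℕ.≤-trans (ℕ.m≤n⊔m (height t₋) _) (ℕ.m≤m⊔n _ _)))
        (bound t₊ (ℕ.m≤n⊔m (height t₋ ⊔ height t₀) _)))
    where
    bound : ∀ t {h} → height t ℕ.≤ h → length (leaves t) ℕ.≤ 3 ℕ.^ h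
    bound t h≤ = ℕ.≤-trans (length-leaves t) (ℕ.^-monoʳ-≤ 3 h≤)

  module _ {n} (f : RationalFunction n) (A : Sequence n) {v : Carrier}
           (hasValue : HasValue f A v) where

    private
      d m : Carrier
      d = eval (denominator f) A
      m = eval (numerator f) A

      0<d*d : 0# < d * d
      0<d*d = square-positive (proj₁ hasValue)

      -- Clears the denominator: as `d * d` is positive, the value `v` of the rational function has
      -- the sign of `m * d`, which is polynomial in the input.
      d*d*v≈m*d : d * d * v ≈ m * d
      d*d*v≈m*d = begin-equality
        d * d * v    ≈⟨ *-assoc d d v ⟩
        d * (d * v)  ≈⟨ *-congˡ (*-comm d v) ⟩
        d * (v * d)  ≈⟨ *-congˡ (proj₂ hasValue) ⟩
        d * m        ≈⟨ *-comm d m ⟩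
        m * d        ∎

    value-neg : v < 0# → m * d < 0#
    value-neg v<0 = <-respˡ-≈ d*d*v≈m*d (pos*neg⇒neg 0<d*d v<0)

    value-zero : v ≈ 0# → m * d ≈ 0#
    value-zero v≈0 = trans (sym d*d*v≈m*d) (trans (*-congˡ v≈0) (zeroʳ _))

    value-pos : 0# < v → 0# < m * d
    value-pos 0<v = <-respʳ-≈ d*d*v≈m*d (*-positive 0<d*d 0<v)

  -- Descent through the tree. At a node, the product of numerator and denominator has a constant
  -- sign for small ε, so a single branch is taken there, and the recursion continues with a smaller
  -- interval.
  eventual-leaf : ∀ {n} (t : DecisionTree n) {X y} →
    Eventually (λ ε → Outputs t (point X ε) y) →
    ∃ λ g → g ∈ leaves t ×
      Eventually (λ ε → ∀ i → HasValue (lookup g i) (point X ε) (lookup y i))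
  eventual-leaf (leaf g) outputs =
    g , here refl , Eventually-map (λ { (leaf hasValues) → hasValues }) outputs
  eventual-leaf {n} (node f t₋ t₀ t₊) {X} {y} outputs = follow (eventualSign md)
    where
    md : UPoly
    md = restrict (numerator f) X ⊠ restrict (denominator f) X

    md-value : ∀ ε → eval (numerator f) (point X ε) *
                     eval (denominator f) (point X ε) ≈ ⟦ md ⟧ ε
    md-value ε = trans
      (*-cong (eval-restrict (numerator f) (point-At ε X))
              (eval-restrict (denominator f) (point-At ε X)))
      (sym (⟦⟧-homo-* (restrict (numerator f) X) (restrict (denominator f) X) ε))

    take₋ : ∀ {ε} → Outputs (node f t₋ t₀ t₊) (point X ε) y → ⟦ md ⟧ ε < 0# →
            Outputs t₋ (point X ε) y
    take₋ {ε} (neg _ _ o)   s = o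
    take₋ {ε} (zer h v≈0 _) s =
      ⊥-elim (irrefl (trans (sym (md-value ε)) (value-zero f (point X ε) h v≈0)) s)
    take₋ {ε} (pos h 0<v _) s =
      ⊥-elim (asym (<-respʳ-≈ (md-value ε) (value-pos f (point X ε) h 0<v)) s)

    take₀ : ∀ {ε} → Outputs (node f t₋ t₀ t₊) (point X ε) y → ⟦ md ⟧ ε ≈ 0# →
            Outputs t₀ (point X ε) y
    take₀ {ε} (neg h v<0 _) z =
      ⊥-elim (irrefl z (<-respˡ-≈ (md-value ε) (value-neg f (point X ε) h v<0)))
    take₀ {ε} (zer _ _ o)   z = o
    take₀ {ε} (pos h 0<v _) z =
      ⊥-elim (irrefl (sym z)
        (<-respʳ-≈ (md-value ε) (value-pos f (point X ε) h 0<v)))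

    take₊ : ∀ {ε} → Outputs (node f t₋ t₀ t₊) (point X ε) y → 0# < ⟦ md ⟧ ε →
            Outputs t₊ (point X ε) y
    take₊ {ε} (neg h v<0 _) s =
      ⊥-elim (asym (<-respˡ-≈ (md-value ε) (value-neg f (point X ε) h v<0)) s)
    take₊ {ε} (zer h v≈0 _) s =
      ⊥-elim (irrefl
        (sym (trans (sym (md-value ε)) (value-zero f (point X ε) h v≈0))) s)
    take₊ {ε} (pos _ _ o)   s = o

    follow : EventualSign md →
      ∃ λ g → g ∈ leaves (node f t₋ t₀ t₊) ×
        Eventually (λ ε → ∀ i → HasValue (lookup g i) (point X ε) (lookup y i))
    follow (negative s) with eventual-leaf t₋ (Eventually-zip take₋ outputs s)
    ... | g , g∈ , hasValues = g , ∈-++⁺ˡ g∈ , hasValues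
    -- Here the product vanishes at every ε, so the middle branch is taken wherever the tree yields
    -- `y`.
    follow (null z)
      with eventual-leaf t₀ (Eventually-map (λ {ε} o → take₀ o (z ε)) outputs)
    ... | g , g∈ , hasValues = g , ∈-++⁺ʳ (leaves t₋) (∈-++⁺ˡ g∈) , hasValues
    follow (positive s) with eventual-leaf t₊ (Eventually-zip take₊ outputs s)
    ... | g , g∈ , hasValues =
      g , ∈-++⁺ʳ (leaves t₋) (∈-++⁺ʳ (leaves t₀) g∈) , hasValues

  -- The equation v · denominator = numerator is polynomial in ε once `v` is fixed; valid for small
  -- ε, it is valid at every parameter, in particular at the one giving `C`.
  HasValue-extend : ∀ {n} (f : RationalFunction n) {X v x C} → At x X C →
    ¬ eval (denominator f) C ≈ 0# →
    Eventually (λ ε → HasValue f (point X ε) v) → HasValue f C v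
  HasValue-extend f {X} {v} {x} {C} at nz hasValues = nz ,
    x∙y⁻¹≈ε⇒x≈y _ _ (trans (difference at)
      (eventually-zero⇒zero d (Eventually-map (λ {ε} h → trans
        (sym (difference (point-At ε X))) (x≈y⇒x∙y⁻¹≈ε (proj₂ h))) hasValues) x))
    where
    d : UPoly
    d = v ⊡ restrict (denominator f) X ⊞ (- 1#) ⊡ restrict (numerator f) X

    difference : ∀ {x A} → At x X A →
      v * eval (denominator f) A - eval (numerator f) A ≈ ⟦ d ⟧ x
    difference {x} at = trans
      (+-cong (trans (*-congˡ (eval-restrict (denominator f) at))
                     (sym (⟦⟧-homo-⊡ v (restrict (denominator f) X) x)))
              (-‿cong (eval-restrict (numerator f) at)))
      (sym (⟦⟧-homo-minus (v ⊡ restrict (denominator f) X) _ x))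

  -- From unique configurations to distinct leaves.

  module _ {n} (t : DecisionTree n) (solves : SolvesMCSP t) where

    private
      -- Only the functions at the leaves have to be defined at `C`. The tests are never evaluated
      -- there, so `C` itself may lead the tree to another leaf.
      generic = generic-point (concatMap toList (leaves t))
      C = proj₁ generic

    denominator-nonzero : ∀ {g} → g ∈ leaves t →
                          ∀ i → ¬ eval (denominator (lookup g i)) C ≈ 0#
    denominator-nonzero {g} g∈ i = All.lookup (proj₂ generic)
      (∈-concatMap⁺ toList (lose g∈ (∈ᵛ-toList⁺ (∈ᵛ-lookup i g))))

    -- Stated at `C` because the lines for different configurations start at different inputs but
    -- all pass through `C`, where their values can be compared.
    ValueAtC : Vec ℕ n → Vec (RationalFunction n) n → Set
    ValueAtC P g = ∀ i → HasValue (lookup g i) C (fromℕ (lookup P i))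

    ValueAtC-injective : ∀ g {P Q} → ValueAtC P g → ValueAtC Q g → P ≡ Q
    ValueAtC-injective g hP hQ = vec-≡ λ i → fromℕ-injective
      (*-cancelʳ-nonzero (proj₁ (hP i))
        (trans (proj₂ (hP i)) (sym (proj₂ (hQ i)))))

    -- The tree must output some output configuration at each point near `A` on the line, and `P` is
    -- the only candidate there.
    eventually-outputs : ∀ {P} ((_ , A , _) : IsUniqueConfiguration P) →
      Eventually (λ ε → Outputs t (point (line A C) ε) (Vec.map fromℕ P))
    eventually-outputs {P} (_ , A , unique) = Eventually-map outputs-P
      (eventually-unique (line-0 A C) (λ Q → to (unique Q)) (from (unique P) refl))
      where
      open Equivalence
      outputs-P : ∀ {B} → (∀ Q → IsOutputConfiguration B Q → Q ≡ P) →
                  Outputs t B (Vec.map fromℕ P)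
      outputs-P {B} only-P with solves B
      ... | Q , output , outputs with refl ← only-P Q output = outputs

    unique-leaf : ∀ {P} → IsUniqueConfiguration P →
                  ∃ λ g → g ∈ leaves t × ValueAtC P g
    unique-leaf {P} isUnique@(_ , A , _)
      with eventual-leaf t (eventually-outputs isUnique)
    ... | g , g∈ , hasValues = g , g∈ , λ i →
      subst (HasValue (lookup g i) C) (lookup-map i fromℕ P)
        (HasValue-extend (lookup g i) (line-1 A C) (denominator-nonzero g∈ i)
          (Eventually-map (λ h → h i) hasValues))

    length-≤-3^height : ∀ {ℙ} → Unique ℙ → All IsUniqueConfiguration ℙ →
                        length ℙ ℕ.≤ 3 ℕ.^ height t
    length-≤-3^height unique isUnique = ℕ.≤-trans
      (length-≤ (λ {_} {_} {g} → ValueAtC-injective g) unique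
        (All.map unique-leaf isUnique))
      (length-leaves t)

  length-≤-3^K : ∀ {n ℙ} → Unique ℙ → All IsUniqueConfiguration ℙ →
                 ∀ K → IsMinimumCost n K → length ℙ ℕ.≤ 3 ℕ.^ K
  length-≤-3^K unique isUnique K ((t , solves , refl) , _) =
    length-≤-3^height t solves unique isUnique

-- The bounds in base 3 and in base 2.

open import Data.Nat.Base using (_≤_; _<_; _*_)

theorem2 : (ℝ : CompleteOrderedField) → let open MCSP ℝ in
    (∀ (n : ℕ) → 1 ≤ n →
    ∀ (ℙ : List (Vec ℕ n)) → Unique ℙ → All IsUniqueConfiguration ℙ →
    ∀ (K : ℕ) → IsMinimumCost n K →
    ⌈log₃ length ℙ ⌉ ≤ K)
    ×
    (∃ λ (c : ℕ) → (0 < c) ×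
    (∀ (n : ℕ) → 1 ≤ n →
    ∀ (ℙ : List (Vec ℕ n)) → Unique ℙ → All IsUniqueConfiguration ℙ →
    ∀ (K : ℕ) → IsMinimumCost n K →
    ⌈log₂ length ℙ ⌉ ≤ c * K))
theorem2 ℝ =
  (λ n _ ℙ unique isUnique K cost →
    Equivalence.from (⌈log₃⌉≤⇔≤3^ (length ℙ) K)
      (length-≤-3^K unique isUnique K cost)) ,
  -- The constant is 2 because 3 ≤ 4 = 2 ^ 2, so `3 ^ K ≤ 2 ^ (2 * K)`.
  2 , s≤s z≤n ,
  λ n _ ℙ unique isUnique K cost → begin
    ⌈log₂ length ℙ ⌉        ≤⟨ ⌈log₂⌉-mono-≤ (length-≤-3^K unique isUnique K cost) ⟩
    ⌈log₂ 3 ℕ.^ K ⌉         ≤⟨ ⌈log₂⌉-mono-≤ (ℕ.^-monoˡ-≤ K (ℕ.n≤1+n 3)) ⟩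
    ⌈log₂ 4 ℕ.^ K ⌉         ≡⟨ cong ⌈log₂_⌉ (ℕ.^-*-assoc 2 2 K) ⟩
    ⌈log₂ 2 ℕ.^ (2 * K) ⌉   ≡⟨ ⌈log₂2^n⌉≡n (2 * K) ⟩
    2 * K                   ∎
  where
  open LowerBound ℝ
  open ℕ.≤-Reasoning
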